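{- Let $(\overline{\mathfrak{p}};\overline{\mathfrak{q}})_{n}=(\mathfrak{p}_{1},\ldots,\mathfrak{p}_{n};\mathfrak{q}_{1},\ldots,\mathfrak{q}_{n})\in \mathcal{LMQB}_{n}$ and $(\overline{\mathfrak{l}};\overline{\mathfrak{s}})_{m}=(\mathfrak{l}_{1},\ldots,\mathfrak{l}_{m};\mathfrak{s}_{1},\ldots,\mathfrak{s}_{m})\in \mathcal{LMQB}_{m}$. For $k=2,\ldots,n$ let $(\overline{\mathfrak{p}};\overline{\mathfrak{q}})_{n}\bullet_{k}(\overline{\mathfrak{l}};\overline{\mathfrak{s}})_{m}$ be the bi-vector whose first component is $$(\mathfrak{p}_{1},\ldots,\mathfrak{p}_{k-2},\ \mathfrak{p}_{k-1}+I,\ \mathfrak{l}_{2}-\mathfrak{s}_{2},\ \mathfrak{l}_{3},\ldots,\mathfrak{l}_{m},\ (\mathfrak{p}_{k}-\mathfrak{q}_{k})-\mathfrak{q}_{k}\mathfrak{l}_{1},\ \mathfrak{p}_{k+1},\ldots,\mathfrak{p}_{n})$$ and whose second component is $$(\mathfrak{q}_{1},\ldots,\mathfrak{q}_{k-1},\ \mathfrak{s}_{2},\ldots,\mathfrak{s}_{m},\ -\mathfrak{q}_{k}\mathfrak{s}_{1},\ \mathfrak{q}_{k+1},\ldots,\mathfrak{q}_{n}),$$ and let $$(\overline{\mathfrak{p}};\overline{\mathfrak{q}})_{n}\bullet_{1}(\overline{\mathfrak{l}};\overline{\mathfrak{s}})_{m}=((\mathfrak{p}_{1}-\mathfrak{q}_{1})-\mathfrak{q}_{1}\mathfrak{l}_{1},\mathfrak{p}_{2},\ldots,\mathfrak{p}_{n-1},\mathfrak{p}_{n}+I,\mathfrak{l}_{2}-\mathfrak{s}_{2},\mathfrak{l}_{3},\ldots,\mathfrak{l}_{m};\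 -\mathfrak{q}_{1}\mathfrak{s}_{1},\mathfrak{q}_{2},\ldots,\mathfrak{q}_{n},\mathfrak{s}_{2},\ldots,\mathfrak{s}_{m}).$$ Then $(\overline{\mathfrak{p}};\overline{\mathfrak{q}})_{n}\bullet_{k}(\overline{\mathfrak{l}};\overline{\mathfrak{s}})_{m}\in \mathcal{LMQB}_{n+m-1}$ for $k=1,\ldots,n$.
   Context: Fix $l\ge 1$; all entries are $l\times l$ matrices (real or complex), $I$ and $O$ are the $l\times l$ identity and zero matrices. A bi-vector $(\mathfrak{p}_{1},\ldots,\mathfrak{p}_{n};\mathfrak{q}_{1},\ldots,\mathfrak{q}_{n})$ of $l\times l$ matrices is called a left matrix quiddity bi-sequence of length $n$ if $$\begin{pmatrix} \mathfrak{p}_{n} & \mathfrak{q}_{n}\\ I & O\end{pmatrix}\cdots\begin{pmatrix} \mathfrak{p}_{1} & \mathfrak{q}_{1}\\ I & O\end{pmatrix}=-\begin{pmatrix} I & O\\ O & I\end{pmatrix}.$$ $\mathcal{LMQB}_{n}$ is the set of all left matrix quiddity bi-sequences of length $n$. -}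

module Defs where

open import Algebra.Bundles using (CommutativeRing)
import Algebra.Properties.Ring as RingProperties
import Algebra.Properties.Semiring.Sum as SemiringSum
open import Data.Bool.Base using (if_then_else_)
open import Data.Fin.Base as Fin using (Fin; zero; suc; toℕ; inject; inject₁; _↑ˡ_; _↑ʳ_)
open import Data.Fin.Patterns using (0F; 1F)
open import Data.Fin.Properties using (_≟_; splitAt-↑ˡ; splitAt-↑ʳ; toℕ-inject₁; toℕ≤pred[n])
open import Data.Nat.Base as ℕ using (ℕ; zero; suc; _∸_; NonZero)
import Data.Nat.Properties as ℕ
open import Data.Nat.Solver using (module +-*-Solver)
open import Data.Product.Base using (_×_; _,_)
open import Data.Vec.Functional
  using (Vector; _∷_; _++_; head; tail; init; last; drop)
open import Function.Base using (_∘_)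
open import Relation.Binary.PropositionalEquality
  using (_≡_; refl; cong; sym; trans; module ≡-Reasoning)
open import Relation.Nullary using (¬_; does; yes; no; contradiction)
open import Relation.Unary using (Pred; _∈_; _∉_)

module _ {a} {A : Set a} where

  -- The entries strictly before, resp. strictly after, position k.
  before : ∀ {n} (k : Fin n) → Vector A n → Vector A (toℕ k)
  before k x = x ∘ inject

  after : ∀ {n} (k : Fin n) → Vector A n → Vector A (n ∸ suc (toℕ k))
  after zero    x = tail x
  after (suc k) x = after k (tail x)

  cast : ∀ {m n} → .(m ≡ n) → Vector A m → Vector A n
  cast eq x = x ∘ Fin.cast (sym eq)

length₁ : ∀ {n} m (j : Fin (suc n)) →
          toℕ (inject₁ j) ℕ.+ (2 ℕ.+ (m ℕ.+ suc (n ∸ toℕ j))) ≡ (2 ℕ.+ n) ℕ.+ (2 ℕ.+ m) ∸ 1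
length₁ {n} m j = begin
  toℕ (inject₁ j) ℕ.+ (2 ℕ.+ (m ℕ.+ suc r))  ≡⟨ cong (ℕ._+ (2 ℕ.+ (m ℕ.+ suc r))) (toℕ-inject₁ j) ⟩
  t ℕ.+ (2 ℕ.+ (m ℕ.+ suc r))                ≡⟨ solve 3 (λ t m r →
      t :+ (con 2 :+ (m :+ (con 1 :+ r))) := con 1 :+ (t :+ r :+ (con 2 :+ m))) refl t m r ⟩
  suc (t ℕ.+ r ℕ.+ (2 ℕ.+ m))                ≡⟨ cong (λ s → suc (s ℕ.+ (2 ℕ.+ m))) (ℕ.m+[n∸m]≡n (toℕ≤pred[n] j)) ⟩
  suc (n ℕ.+ (2 ℕ.+ m))                      ∎
  where
  open ≡-Reasoning
  open +-*-Solver
  t = toℕ j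
  r = n ∸ toℕ j

length₂ : ∀ {n} m (j : Fin (suc n)) →
          toℕ (Fin.suc j) ℕ.+ (1 ℕ.+ m ℕ.+ suc (n ∸ toℕ j)) ≡ (2 ℕ.+ n) ℕ.+ (2 ℕ.+ m) ∸ 1
length₂ {n} m j = begin
  suc (t ℕ.+ (suc m ℕ.+ suc r))  ≡⟨ cong suc (solve 3 (λ t m r →
      t :+ (con 1 :+ m :+ (con 1 :+ r)) := t :+ r :+ (con 2 :+ m)) refl t m r) ⟩
  suc (t ℕ.+ r ℕ.+ (2 ℕ.+ m))    ≡⟨ cong (λ s → suc (s ℕ.+ (2 ℕ.+ m))) (ℕ.m+[n∸m]≡n (toℕ≤pred[n] j)) ⟩
  suc (n ℕ.+ (2 ℕ.+ m))          ∎
  where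
  open ≡-Reasoning
  open +-*-Solver
  t = toℕ j
  r = n ∸ toℕ j

-- Scalars form an arbitrary commutative ring R, which covers both the
-- real and the complex numbers.

module Quiddity {c ℓ} (R : CommutativeRing c ℓ) (l : ℕ) where

  open CommutativeRing R
    renaming (refl to ≈-refl; sym to ≈-sym; trans to ≈-trans; zero to *-zero)
  open SemiringSum semiring using (sum)

  infix  4 _≋_
  infix  8 ⊝_
  infixl 7 _⊗_
  infixl 6 _⊕_ _⊖_

  Matrix : ℕ → ℕ → Set c
  Matrix r s = Vector (Vector Carrier s) r

  _≋_ : ∀ {r s} → Matrix r s → Matrix r s → Set ℓ
  A ≋ B = ∀ i j → A i j ≈ B i j

  _⊕_ _⊖_ : ∀ {r s} → Matrix r s → Matrix r s → Matrix r s
  (A ⊕ B) i j = A i j + B i j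
  (A ⊖ B) i j = A i j - B i j

  ⊝_ : ∀ {r s} → Matrix r s → Matrix r s
  (⊝ A) i j = - A i j

  _⊗_ : ∀ {r s t} → Matrix r s → Matrix s t → Matrix r t
  (A ⊗ B) i j = sum λ k → A i k * B k j

  identity : ∀ n → Matrix n n
  identity n i j = if does (i ≟ j) then 1# else 0#

  Mat : Set c
  Mat = Matrix l l

  I O : Mat
  I = identity l
  O i j = 0#

  -- The 2l × 2l matrix with rows of blocks (A B) and (C D).
  block : Mat → Mat → Mat → Mat → Matrix (l ℕ.+ l) (l ℕ.+ l)
  block A B C D = (λ i → A i ++ B i) ++ (λ i → C i ++ D i)

  M : Mat → Mat → Matrix (l ℕ.+ l) (l ℕ.+ l)
  M p q = block p q I O

  -- Later factors stand on the left: M pₙ qₙ ⊗ ⋯ ⊗ M p₁ q₁.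
  product : ∀ {n} → Vector Mat n → Vector Mat n → Matrix (l ℕ.+ l) (l ℕ.+ l)
  product {zero}  p q = identity (l ℕ.+ l)
  product {suc n} p q = product (tail p) (tail q) ⊗ M (head p) (head q)

  BiVector : ℕ → Set c
  BiVector n = Vector Mat n × Vector Mat n

  LMQB : ∀ n → Pred (BiVector n) ℓ
  LMQB n (p , q) = product p q ≋ ⊝ block I O O I

  -- The composition •ₖ.  Positions are counted from 0, so pᵢ is p (i - 1);
  -- in the second clause k = j + 2, hence p (inject₁ j) is pₖ₋₁ and
  -- p (suc j) is pₖ.  The formulas refer to l₂ and s₂, and for k = 1 to
  -- distinct p₁ and pₙ, so both lengths are at least 2; see LMQB₁-empty
  -- for length 1.
  _•[_]_ : ∀ {n m} → BiVector (2 ℕ.+ n) → Fin (2 ℕ.+ n) → BiVector (2 ℕ.+ m) →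
           BiVector ((2 ℕ.+ n) ℕ.+ (2 ℕ.+ m) ∸ 1)
  _•[_]_ {n} {m} (p , q) zero (𝔩 , 𝔰) =
      (((p 0F ⊖ q 0F) ⊖ q 0F ⊗ 𝔩 0F) ∷ tail (init p) ++
         (last p ⊕ I) ∷ (𝔩 1F ⊖ 𝔰 1F) ∷ drop 2 𝔩)
    , cast (cong suc (sym (ℕ.+-suc n (suc m))))
        ((⊝ (q 0F ⊗ 𝔰 0F)) ∷ tail q ++ tail 𝔰)
  _•[_]_ {n} {m} (p , q) (suc j) (𝔩 , 𝔰) =
      cast (length₁ m j)
        (before (inject₁ j) p ++
         (p (inject₁ j) ⊕ I) ∷ (𝔩 1F ⊖ 𝔰 1F) ∷ drop 2 𝔩 ++
         ((p (suc j) ⊖ q (suc j)) ⊖ q (suc j) ⊗ 𝔩 0F) ∷ after (suc j) p)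
    , cast (length₂ m j)
        (before (suc j) q ++
         tail 𝔰 ++
         (⊝ (q (suc j) ⊗ 𝔰 0F)) ∷ after (suc j) q)

  private

    open SemiringSum semiring using (sum-cong-≋; sum-replicate-zero)

    identity-suc : ∀ {n} (i j : Fin n) → identity (suc n) (suc i) (suc j) ≡ identity n i j
    identity-suc i j with i ≟ j
    ... | yes _ = refl
    ... | no _  = refl

    sum-identity : ∀ {n} (i : Fin n) (f : Vector Carrier n) →
                   sum (λ k → identity n i k * f k) ≈ f i
    sum-identity {suc n} zero f = ≈-trans
      (+-cong (*-identityˡ _)
        (≈-trans (sum-cong-≋ {n} (λ k → zeroˡ _)) (sum-replicate-zero n)))
      (+-identityʳ _)
    sum-identity {suc n} (suc i) f = ≈-trans
      (+-cong (zeroˡ _)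
        (≈-trans (sum-cong-≋ {n} (λ k → *-congʳ (reflexive (identity-suc i k))))
                 (sum-identity i (tail f))))
      (+-identityˡ _)

    block-↑ʳ-↑ˡ : ∀ A B C D i j → block A B C D (l ↑ʳ i) (j ↑ˡ l) ≡ C i j
    block-↑ʳ-↑ˡ A B C D i j rewrite splitAt-↑ʳ l l i | splitAt-↑ˡ l j l = refl

    identity-diagonal : ∀ {n} (i : Fin n) → identity n i i ≡ 1#
    identity-diagonal i with i ≟ i
    ... | yes _  = refl
    ... | no i≢i = contradiction refl i≢i

  LMQB₁-empty : .{{_ : NonZero l}} → ¬ (1# ≈ 0#) → ∀ pq → pq ∉ LMQB 1
  LMQB₁-empty 1≉0 (p , q) h = nonempty l refl
    where
    open RingProperties ring using (-0#≈0#)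

    nonempty : ∀ k .{{_ : NonZero k}} → ¬ (k ≡ l)
    nonempty (suc k) refl = 1≉0 (≈-trans (≈-sym lhs) (≈-trans (h (l ↑ʳ 0F) (0F ↑ˡ l)) rhs))
      where
      lhs : product p q (l ↑ʳ 0F) (0F ↑ˡ l) ≈ 1#
      lhs = ≈-trans (sum-identity (l ↑ʳ 0F) (λ k → M (p 0F) (q 0F) k (0F ↑ˡ l)))
        (reflexive (trans (block-↑ʳ-↑ˡ (p 0F) (q 0F) I O 0F 0F) (identity-diagonal {l} 0F)))

      rhs : - block I O O I (l ↑ʳ 0F) (0F ↑ˡ l) ≈ 0#
      rhs = ≈-trans (-‿cong (reflexive (block-↑ʳ-↑ˡ I O O I 0F 0F))) -0#≈0#

{-# OPTIONS --safe #-}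
module Submission where

-- With N = (I O; -I I), J = (I I; I O) and T = (-q  p-q; O I) as block matrices,
--   M (𝔩₂ - 𝔰₂) 𝔰₂ = M 𝔩₂ 𝔰₂ N,   M (p′ + I) q′ = J M p′ q′,
--   M (p - q - q 𝔩) (-q 𝔰) = T M 𝔩 𝔰,   T N J = - M p q.
-- For W = M 𝔩ₘ 𝔰ₘ ⋯ M 𝔩₂ 𝔰₂, the inserted part of the product is therefore
-- T (M 𝔩₁ 𝔰₁ W) N J M p′ q′.  Here M 𝔩₁ 𝔰₁ W = - 1, because W M 𝔩₁ 𝔰₁ = - 1 and
-- one-sided inverses of square matrices over a commutative ring are two-sided,
-- so the inserted part collapses to M p q M p′ q′.  For k = 1 the same holds
-- after a cyclic rotation of the product.

open import Defs
open import Algebra.Bundles using (CommutativeRing; Ring)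
import Algebra.Construct.Pointwise as Pointwise
import Algebra.Properties.CommutativeSemigroup as CommutativeSemigroupProperties
import Algebra.Properties.CommutativeSemiring.Exp as Exp
import Algebra.Properties.Ring as RingProperties
import Algebra.Properties.Semiring.Sum as SemiringSum
open import Data.Fin.Base using (Fin; zero; suc; punchIn; _↑ˡ_; _↑ʳ_; splitAt; join; inject₁)
open import Data.Fin.Patterns using (0F; 1F)
open import Data.Fin.Properties
  using (_≟_; punchInᵢ≢i; punchIn-punchOut; join-splitAt; splitAt-↑ˡ; splitAt-↑ʳ; ↑ˡ-injective; ↑ʳ-injective; suc-injective)
open import Data.Nat.Base as ℕ using (ℕ; zero; suc)
import Data.Nat.Properties as ℕ
open import Data.List.Base using (List; []; _∷_; _++_; length)
open import Data.List.Properties using (++-assoc; length-tabulate; tabulate-cong)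
open import Data.Product.Base using (∃; _,_; proj₁; proj₂)
open import Data.Sum.Base using (_⊎_; inj₁; inj₂)
open import Data.Sum.Properties using ([,]-map)
open import Data.Vec.Functional as Vector using (Vector; tail; init; last; removeAt; toList)
open import Function.Base using (_∘_)
open import Relation.Binary.PropositionalEquality as ≡ using (_≡_; _≢_)
import Relation.Binary.Reasoning.Setoid as SetoidReasoning
open import Relation.Nullary using (yes; no; contradiction)
open import Relation.Unary using (_∈_)

-- Functional vectors as lists.

module _ {a} {A : Set a} where

  toList-++ : ∀ {m n} (x : Vector A m) (y : Vector A n) → toList (x Vector.++ y) ≡ toList x ++ toList y
  toList-++ {zero}  x y = ≡.refl
  toList-++ {suc m} x y = ≡.cong (x zero ∷_) (≡.trans
    (tabulate-cong (λ i → [,]-map (splitAt m i))) (toList-++ (tail x) y))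

  toList-cast : ∀ {m n} .(eq : m ≡ n) (x : Vector A m) → toList (cast eq x) ≡ toList x
  toList-cast {zero}  {zero}  eq x = ≡.refl
  toList-cast {suc m} {suc n} eq x = ≡.cong (x zero ∷_) (toList-cast (ℕ.suc-injective eq) (tail x))

  toList-init-last : ∀ {n} (x : Vector A (suc n)) → toList x ≡ toList (init x) ++ last x ∷ []
  toList-init-last {zero}  x = ≡.refl
  toList-init-last {suc n} x = ≡.cong (x zero ∷_) (toList-init-last (tail x))

  -- The two entries singled out are those at the adjacent positions k - 1 and k, between which the
  -- composition inserts.
  toList-before-after : ∀ {n} (j : Fin (suc n)) (x : Vector A (2 ℕ.+ n)) →
    toList x ≡ toList (before (inject₁ j) x) ++ x (inject₁ j) ∷ x (suc j) ∷ toList (after (suc j) x)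
  toList-before-after         zero    x = ≡.refl
  toList-before-after {suc n} (suc j) x = ≡.cong (x zero ∷_) (toList-before-after j (tail x))

  -- The composition cuts its first component before position k - 1 and its second component after
  -- it; this moves one entry so that the cuts agree.
  toList-before-suc : ∀ {n} (j : Fin n) (x : Vector A (suc n)) →
    toList (before (suc j) x) ≡ toList (before (inject₁ j) x) ++ x (inject₁ j) ∷ []
  toList-before-suc zero    x = ≡.refl
  toList-before-suc (suc j) x = ≡.cong (x zero ∷_) (toList-before-suc j (tail x))

-- Elements annihilated by a power of a scalar.

module Torsion {c ℓ} (R : CommutativeRing c ℓ) where

  open CommutativeRing R renaming (zero to *-zero)
  open CommutativeSemigroupProperties *-commutativeSemigroup using (x∙yz≈y∙xz)
  open Exp commutativeSemiring
  open SemiringSum semiring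
  open SetoidReasoning setoid

  -- Equivalently, z becomes zero in the localization of R at the powers of x. Working with explicit
  -- exponents allows elimination with an arbitrary pivot, with no division and no test for zero.
  Torsion : Carrier → Carrier → Set ℓ
  Torsion x z = ∃ λ n → x ^ n * z ≈ 0#

  Torsion-resp : ∀ {x y w z} → x ≈ y → w ≈ z → Torsion x w → Torsion y z
  Torsion-resp x≈y w≈z (n , h) = n , trans (sym (*-cong (^-congˡ n x≈y) w≈z)) h

  Torsion-* : ∀ {x z} r → Torsion x z → Torsion x (r * z)
  Torsion-* {x} {z} r (n , h) = n , (begin
    x ^ n * (r * z)  ≈⟨ x∙yz≈y∙xz _ _ _ ⟩
    r * (x ^ n * z)  ≈⟨ *-congˡ h ⟩
    r * 0#           ≈⟨ zeroʳ r ⟩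
    0#               ∎)

  Torsion-*ˡ : ∀ {x z} r → Torsion x z → Torsion (r * x) z
  Torsion-*ˡ {x} {z} r (n , h) = n , (begin
    (r * x) ^ n * z      ≈⟨ *-congʳ (^-distrib-* r x n) ⟩
    r ^ n * x ^ n * z    ≈⟨ *-assoc _ _ _ ⟩
    r ^ n * (x ^ n * z)  ≈⟨ *-congˡ h ⟩
    r ^ n * 0#           ≈⟨ zeroʳ _ ⟩
    0#                   ∎)

  -- Inverting `r * s` inverts r as well. The extra exponent supplies the factor r that turns z into
  -- `r * z`.
  Torsion-cancel-* : ∀ {r s z} → Torsion (r * s) (r * z) → Torsion (r * s) z
  Torsion-cancel-* {r} {s} {z} (n , h) = suc n , (begin
    r * s * x ^ n * z      ≈⟨ *-assoc _ _ _ ⟩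
    r * s * (x ^ n * z)    ≈⟨ *-congʳ (*-comm r s) ⟩
    s * r * (x ^ n * z)    ≈⟨ *-assoc _ _ _ ⟩
    s * (r * (x ^ n * z))  ≈⟨ *-congˡ (x∙yz≈y∙xz _ _ _) ⟩
    s * (x ^ n * (r * z))  ≈⟨ *-congˡ h ⟩
    s * 0#                 ≈⟨ zeroʳ s ⟩
    0#                     ∎)
    where x = r * s

  Torsion-+ : ∀ {x w z} → Torsion x w → Torsion x z → Torsion x (w + z)
  Torsion-+ {x} {w} {z} (m , g) (n , h) = m ℕ.+ n , (begin
    x ^ (m ℕ.+ n) * (w + z)                        ≈⟨ *-congʳ (^-homo-* x m n) ⟩
    x ^ m * x ^ n * (w + z)                        ≈⟨ distribˡ _ w z ⟩
    x ^ m * x ^ n * w + x ^ m * x ^ n * z          ≈⟨ +-cong (*-congʳ (*-comm _ _)) (*-assoc _ _ _) ⟩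
    x ^ n * x ^ m * w + x ^ m * (x ^ n * z)        ≈⟨ +-cong (trans (*-assoc _ _ _) (*-congˡ g)) (*-congˡ h) ⟩
    x ^ n * 0# + x ^ m * 0#                        ≈⟨ +-cong (zeroʳ _) (zeroʳ _) ⟩
    0# + 0#                                        ≈⟨ +-identityʳ 0# ⟩
    0#                                             ∎)

  Torsion-sum : ∀ {n x} (z : Vector Carrier n) → (∀ i → Torsion x (z i)) → Torsion x (sum z)
  Torsion-sum {zero}  z h = 0 , zeroʳ _
  Torsion-sum {suc n} z h = Torsion-+ (h zero) (Torsion-sum (tail z) (h ∘ suc))

  Torsion-complement : ∀ {x w z} → w + z ≈ 0# → Torsion x z → Torsion x w
  Torsion-complement {x} {w} {z} w+z≈0 (n , h) = n , (begin
    x ^ n * w              ≈⟨ +-identityʳ _ ⟨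
    x ^ n * w + 0#         ≈⟨ +-congˡ h ⟨
    x ^ n * w + x ^ n * z  ≈⟨ distribˡ _ w z ⟨
    x ^ n * (w + z)        ≈⟨ *-congˡ w+z≈0 ⟩
    x ^ n * 0#             ≈⟨ zeroʳ _ ⟩
    0#                     ∎)

  -- Every monomial of the expanded power contains `x ^ m` or `y ^ n`. The local `go` replaces the
  -- binomial theorem by induction: peeling off one factor `x + y` leaves `x * z` and `y * z`, and
  -- each of them needs one power less of x or of y.
  Torsion-+ˡ : ∀ {x y z} → Torsion x z → Torsion y z → Torsion (x + y) z
  Torsion-+ˡ {x} {y} (m , g) (n , h) = m ℕ.+ n , go m n _ g h
    where
    go : ∀ m n z → x ^ m * z ≈ 0# → y ^ n * z ≈ 0# → (x + y) ^ (m ℕ.+ n) * z ≈ 0#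
    go zero    n       z g h = trans (*-congˡ (trans (sym (*-identityˡ z)) g)) (zeroʳ _)
    go (suc m) zero    z g h = trans (*-congˡ (trans (sym (*-identityˡ z)) h)) (zeroʳ _)
    go (suc m) (suc n) z g h = begin
      (x + y) * (x + y) ^ k * z                      ≈⟨ *-congʳ (*-comm _ _) ⟩
      (x + y) ^ k * (x + y) * z                      ≈⟨ *-assoc _ _ _ ⟩
      (x + y) ^ k * ((x + y) * z)                    ≈⟨ *-congˡ (distribʳ z x y) ⟩
      (x + y) ^ k * (x * z + y * z)                  ≈⟨ distribˡ _ _ _ ⟩
      (x + y) ^ k * (x * z) + (x + y) ^ k * (y * z)  ≈⟨ +-cong
        (go m (suc n) (x * z) (shift x m g) (trans (x∙yz≈y∙xz _ _ _) (trans (*-congˡ h) (zeroʳ x))))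
        (trans (*-congʳ (^-congʳ _ (ℕ.+-suc m n)))
          (go (suc m) n (y * z) (trans (x∙yz≈y∙xz _ _ _) (trans (*-congˡ g) (zeroʳ y))) (shift y n h))) ⟩
      0# + 0#                                        ≈⟨ +-identityʳ 0# ⟩
      0#                                             ∎
      where
      k = m ℕ.+ suc n

      shift : ∀ w j → w ^ suc j * z ≈ 0# → w ^ j * (w * z) ≈ 0#
      shift w j e = trans (sym (*-assoc _ w z)) (trans (*-congʳ (*-comm _ w)) e)

  Torsion-sumˡ : ∀ {n z} (x : Vector Carrier n) → (∀ i → Torsion (x i) z) → Torsion (sum x) z
  -- The empty sum is 0. The exponent is 1 because `0# ^ 0` is `1#`, which would leave z itself.
  Torsion-sumˡ {zero}  {z} x h = 1 , trans (*-congʳ (zeroˡ _)) (zeroˡ z)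
  Torsion-sumˡ {suc n} {z} x h = Torsion-+ˡ (h zero) (Torsion-sumˡ (tail x) (h ∘ suc))

  Torsion-square : ∀ {x z} → Torsion (x * x) z → Torsion x z
  Torsion-square {x} {z} (n , h) = n ℕ.+ n ,
    trans (*-congʳ (trans (^-homo-* x n n) (sym (^-distrib-* x x n)))) h

  Torsion-1# : ∀ {z} → Torsion 1# z → z ≈ 0#
  Torsion-1# {z} (n , h) = begin
    z           ≈⟨ *-identityˡ z ⟨
    1# * z      ≈⟨ *-congʳ (1^n≈1 n) ⟨
    1# ^ n * z  ≈⟨ h ⟩
    0#          ∎
    where
    1^n≈1 : ∀ n → 1# ^ n ≈ 1#
    1^n≈1 zero    = refl
    1^n≈1 (suc n) = trans (*-identityˡ _) (1^n≈1 n)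

-- Matrices over a commutative ring: one-sided inverses are two-sided.

module MatrixAlgebra {c ℓ} (R : CommutativeRing c ℓ) (l : ℕ) where

  open Quiddity R l
  open CommutativeRing R renaming (zero to *-zero)
  open RingProperties ring using (-0#≈0#; -‿distribˡ-*; x∙y⁻¹≈ε⇒x≈y)
  open SemiringSum semiring
  open Torsion R

  identity-diagonal : ∀ {n} (i : Fin n) → identity n i i ≈ 1#
  identity-diagonal i with i ≟ i
  ... | yes _  = refl
  ... | no i≢i = contradiction ≡.refl i≢i

  identity-off-diagonal : ∀ {n} {i j : Fin n} → i ≢ j → identity n i j ≈ 0#
  identity-off-diagonal {i = i} {j} i≢j with i ≟ j
  ... | yes i≡j = contradiction i≡j i≢j
  ... | no _    = refl

  -- Serves twice: for `suc`, when elimination drops the first row and column, and for the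
  -- embeddings of `Fin l` onto the two halves of `Fin (l + l)`.
  identity-injective : ∀ {m n} (f : Fin m → Fin n) → (∀ {i j} → f i ≡ f j → i ≡ j) →
                       ∀ i j → identity n (f i) (f j) ≈ identity m i j
  identity-injective f inj i j with i ≟ j
  ... | yes ≡.refl = identity-diagonal (f i)
  ... | no i≢j     = identity-off-diagonal (i≢j ∘ inj)

  sum-zero : ∀ {n} {f : Vector Carrier n} → (∀ i → f i ≈ 0#) → sum f ≈ 0#
  sum-zero {n} h = trans (sum-cong-≋ h) (sum-replicate-zero n)

  sum-combination : ∀ {n} a b (f g z : Vector Carrier n) →
                    sum (λ k → (a * f k - b * g k) * z k) ≈
                    a * sum (λ k → f k * z k) - b * sum (λ k → g k * z k)
  sum-combination {n} a b f g z = begin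
    sum (λ k → (a * f k - b * g k) * z k)
      ≈⟨ sum-cong-≋ {n} (λ k → trans (distribʳ _ _ _) (+-cong (*-assoc _ _ _)
           (trans (*-congʳ (-‿distribˡ-* _ _)) (*-assoc _ _ _)))) ⟩
    sum (λ k → a * (f k * z k) + - b * (g k * z k))
      ≈⟨ ∑-distrib-+ (λ k → a * (f k * z k)) (λ k → - b * (g k * z k)) ⟩
    sum (λ k → a * (f k * z k)) + sum (λ k → - b * (g k * z k))
      ≈⟨ +-cong (*-distribˡ-sum a (λ k → f k * z k)) (*-distribˡ-sum (- b) (λ k → g k * z k)) ⟨
    a * sum (λ k → f k * z k) + - b * sum (λ k → g k * z k)
      ≈⟨ +-congˡ (-‿distribˡ-* _ _) ⟨
    a * sum (λ k → f k * z k) - b * sum (λ k → g k * z k) ∎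
    where open SetoidReasoning setoid

  -- Eliminating column k with the pivot A₀ₖ leaves a smaller system whose
  -- right inverse up to scale is a submatrix of B, so the other entries of y
  -- are (A₀ₖ s)-torsion, and then yₖ is too.  The pivots generate s, as
  -- s = Σₖ A₀ₖ Bₖ₀, hence y is s-torsion.
  kernel-torsion : ∀ {n} s (A B : Matrix n n) (y : Vector Carrier n) →
                   (∀ i j → (A ⊗ B) i j ≈ s * identity n i j) →
                   (∀ i → sum (λ k → A i k * y k) ≈ 0#) →
                   ∀ i → Torsion s (y i)
  -- Each `A zero k * s` has a power killing the entry; weighting these scales with `B k zero` and
  -- summing yields `s * s`, whence the square.
  kernel-torsion {suc n} s A B y AB Ay i = Torsion-square (Torsion-resp pivots refl
    (Torsion-sumˡ (λ k → B k zero * (A zero k * s)) (λ k → Torsion-*ˡ (B k zero) (pivot-torsion k))))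
    where
    open SetoidReasoning setoid

    pivots : sum (λ k → B k zero * (A zero k * s)) ≈ s * s
    pivots = begin
      sum (λ k → B k zero * (A zero k * s))  ≈⟨ sum-cong-≋ {suc n} (λ k →
                                                trans (sym (*-assoc _ _ s)) (*-congʳ (*-comm (B k zero) (A zero k)))) ⟩
      sum (λ k → A zero k * B k zero * s)    ≈⟨ *-distribʳ-sum s (λ k → A zero k * B k zero) ⟨
      (A ⊗ B) zero zero * s                  ≈⟨ *-congʳ (AB zero zero) ⟩
      s * 1# * s                             ≈⟨ *-congʳ (*-identityʳ s) ⟩
      s * s                                  ∎

    module _ (k : Fin (suc n)) where

      a = A zero k

      row : Fin n → Vector Carrier (suc n)
      row i j = a * A (suc i) j - A (suc i) k * A zero j

      row-pivot : ∀ i → row i k ≈ 0#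
      row-pivot i = trans (+-congʳ (*-comm _ _)) (-‿inverseʳ _)

      minor : Matrix n n
      minor i = removeAt (row i) k

      -- The row operation makes the entry in column k vanish, so deleting that column leaves the
      -- sum unchanged.
      minor-sum : ∀ i z → sum (λ j → minor i j * removeAt z k j) ≈
                  a * sum (λ j → A (suc i) j * z j) - A (suc i) k * sum (λ j → A zero j * z j)
      minor-sum i z = begin
        sum (λ j → minor i j * removeAt z k j)                    ≈⟨ +-identityˡ _ ⟨
        0# + sum (λ j → minor i j * removeAt z k j)               ≈⟨ +-congʳ (trans (*-congʳ (row-pivot i)) (zeroˡ _)) ⟨
        row i k * z k + sum (λ j → minor i j * removeAt z k j)    ≈⟨ sum-remove {i = k} (λ j → row i j * z j) ⟨
        sum (λ j → row i j * z j)                                 ≈⟨ sum-combination a (A (suc i) k) (A (suc i)) (A zero) z ⟩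
        a * sum (λ j → A (suc i) j * z j) - A (suc i) k * sum (λ j → A zero j * z j) ∎

      -- The correction term carries the entry of `A ⊗ B` in row `zero` and column `suc j`. It lies
      -- off the diagonal and is zero, which is why the first column of B is dropped.
      minor-inverse : ∀ i j → (minor ⊗ (λ h → B (punchIn k h) ∘ suc)) i j ≈ a * s * identity n i j
      minor-inverse i j = begin
        sum (λ h → minor i h * B (punchIn k h) (suc j))
          ≈⟨ minor-sum i (λ h → B h (suc j)) ⟩
        a * (A ⊗ B) (suc i) (suc j) - A (suc i) k * (A ⊗ B) zero (suc j)
          ≈⟨ +-cong (*-congˡ (trans (AB (suc i) (suc j)) (*-congˡ (identity-injective suc suc-injective i j))))
               (-‿cong (trans (*-congˡ (trans (AB zero (suc j)) (zeroʳ s))) (zeroʳ _))) ⟩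
        a * (s * identity n i j) - 0#
          ≈⟨ trans (+-congˡ -0#≈0#) (+-identityʳ _) ⟩
        a * (s * identity n i j)
          ≈⟨ *-assoc _ _ _ ⟨
        a * s * identity n i j ∎

      minor-kernel : ∀ i → sum (λ j → minor i j * removeAt y k j) ≈ 0#
      minor-kernel i = begin
        sum (λ j → minor i j * removeAt y k j)
          ≈⟨ minor-sum i y ⟩
        a * sum (λ j → A (suc i) j * y j) - A (suc i) k * sum (λ j → A zero j * y j)
          ≈⟨ +-cong (trans (*-congˡ (Ay (suc i))) (zeroʳ _)) (-‿cong (trans (*-congˡ (Ay zero)) (zeroʳ _))) ⟩
        0# - 0#
          ≈⟨ -‿inverseʳ 0# ⟩
        0# ∎

      other-torsion : ∀ j → Torsion (a * s) (removeAt y k j)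
      -- Recursion on the size. The scale grows by the pivot, so the induction has to admit right
      -- inverses up to a scale.
      other-torsion = kernel-torsion (a * s) minor (λ h → B (punchIn k h) ∘ suc) (removeAt y k)
        minor-inverse minor-kernel

      pivot-torsion : Torsion (a * s) (y i)
      pivot-torsion with k ≟ i
      ... | no k≢i     = ≡.subst (Torsion (a * s) ∘ y) (punchIn-punchOut k≢i) (other-torsion _)
      -- Row `zero` of the system expresses `a * y k` through the other entries, already torsion; a
      -- divides the scale `a * s` and cancels.
      ... | yes ≡.refl = Torsion-cancel-* (Torsion-complement
        (trans (sym (sum-remove {i = k} (λ j → A zero j * y j))) (Ay zero))
        (Torsion-sum _ (λ j → Torsion-* _ (other-torsion j))))

  matrixRing : ℕ → Ring c ℓ
  matrixRing n = record
    { _≈_    = _≋_ {n} {n}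
    ; _*_    = _⊗_
    ; -_     = ⊝_
    ; 1#     = identity n
    ; isRing = record
      { +-isAbelianGroup = Pointwise.isAbelianGroup (Fin n) (Pointwise.isAbelianGroup (Fin n) +-isAbelianGroup)
      ; *-cong     = λ A≋B C≋D i j → sum-cong-≋ {n} (λ k → *-cong (A≋B i k) (C≋D k j))
      ; *-assoc    = ⊗-assoc
      ; *-identity = ⊗-identityˡ , ⊗-identityʳ
      ; distrib    = ⊗-distribˡ , ⊗-distribʳ
      }
    }
    where
    open SetoidReasoning setoid

    -- Phrased for any g that behaves as a Kronecker delta at i, so that both rows and columns of
    -- the identity matrix qualify.
    sum-identity : ∀ {n} (f : Fin n → Carrier) i {g : Fin n → Carrier} →
                   g i ≈ 1# → (∀ {k} → k ≢ i → g k ≈ 0#) → sum (λ k → g k * f k) ≈ f i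
    sum-identity {suc n} f i {g} gᵢ≈1 g≈0 = begin
      sum (λ k → g k * f k)                                      ≈⟨ sum-remove {i = i} (λ k → g k * f k) ⟩
      g i * f i + sum (λ k → g (punchIn i k) * f (punchIn i k))  ≈⟨ +-cong
        (trans (*-congʳ gᵢ≈1) (*-identityˡ _))
        (sum-zero {n} (λ k → trans (*-congʳ (g≈0 (punchInᵢ≢i i k))) (zeroˡ _))) ⟩
      f i + 0#                                                   ≈⟨ +-identityʳ _ ⟩
      f i                                                        ∎

    ⊗-identityˡ : ∀ A → identity n ⊗ A ≋ A
    ⊗-identityˡ A i j = sum-identity (λ k → A k j) i (identity-diagonal i) (identity-off-diagonal ∘ ≡.≢-sym)

    ⊗-identityʳ : ∀ A → A ⊗ identity n ≋ A
    ⊗-identityʳ A i j = trans (sum-cong-≋ {n} (λ k → *-comm _ _))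
      (sum-identity (A i) j (identity-diagonal j) identity-off-diagonal)

    ⊗-assoc : ∀ A B C → (A ⊗ B) ⊗ C ≋ A ⊗ (B ⊗ C)
    ⊗-assoc A B C i j = begin
      sum (λ k → sum (λ h → A i h * B h k) * C k j)    ≈⟨ sum-cong-≋ {n} (λ k → *-distribʳ-sum (C k j) (λ h → A i h * B h k)) ⟩
      sum (λ k → sum (λ h → A i h * B h k * C k j))    ≈⟨ ∑-comm (λ k h → A i h * B h k * C k j) ⟩
      sum (λ h → sum (λ k → A i h * B h k * C k j))    ≈⟨ sum-cong-≋ {n} (λ h → sum-cong-≋ {n} (λ k → *-assoc _ _ _)) ⟩
      sum (λ h → sum (λ k → A i h * (B h k * C k j)))  ≈⟨ sum-cong-≋ {n} (λ h → *-distribˡ-sum (A i h) (λ k → B h k * C k j)) ⟨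
      sum (λ h → A i h * sum (λ k → B h k * C k j))    ∎

    ⊗-distribˡ : ∀ A B C → A ⊗ (B ⊕ C) ≋ (A ⊗ B) ⊕ (A ⊗ C)
    ⊗-distribˡ A B C i j = trans (sum-cong-≋ {n} (λ k → distribˡ _ _ _))
      (∑-distrib-+ (λ k → A i k * B k j) (λ k → A i k * C k j))

    ⊗-distribʳ : ∀ A B C → (B ⊕ C) ⊗ A ≋ (B ⊗ A) ⊕ (C ⊗ A)
    ⊗-distribʳ A B C i j = trans (sum-cong-≋ {n} (λ k → distribʳ _ _ _))
      (∑-distrib-+ (λ k → B i k * A k j) (λ k → C i k * A k j))

  -- The columns of `B ⊗ A ⊖ identity n` lie in the kernel of A, because A B A = A. With scale 1,
  -- torsion means zero.
  inverse-comm : ∀ {n} (A B : Matrix n n) → A ⊗ B ≋ identity n → B ⊗ A ≋ identity n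
  inverse-comm {n} A B AB i j = x∙y⁻¹≈ε⇒x≈y _ _ (Torsion-1# (kernel-torsion 1# A B (λ k → Y k j)
    (λ i j → trans (AB i j) (sym (*-identityˡ _))) (λ i → AY i j) i))
    where
    module 𝕄 = Ring (matrixRing n)
    open SetoidReasoning 𝕄.setoid
    Y = B ⊗ A ⊖ identity n

    AY : A ⊗ Y ≋ 𝕄.0#
    AY = begin
      A ⊗ Y                            ≈⟨ RingProperties.x[y-z]≈xy-xz (matrixRing n) A (B ⊗ A) (identity n) ⟩
      A ⊗ (B ⊗ A) ⊖ A ⊗ identity n     ≈⟨ 𝕄.+-cong (𝕄.trans (𝕄.sym (𝕄.*-assoc A B A)) (𝕄.*-congʳ AB))
                                          (𝕄.-‿cong (𝕄.*-identityʳ A)) ⟩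
      identity n ⊗ A ⊖ A               ≈⟨ 𝕄.+-congʳ (𝕄.*-identityˡ A) ⟩
      A ⊖ A                            ≈⟨ 𝕄.-‿inverseʳ A ⟩
      𝕄.0#                             ∎

  -- Allows a product equal to -1 to be rotated cyclically.
  negative-inverse-comm : ∀ {n} (A B : Matrix n n) → A ⊗ B ≋ ⊝ identity n → B ⊗ A ≋ ⊝ identity n
  negative-inverse-comm {n} A B AB = begin
    B ⊗ A           ≈⟨ ℙ.-‿involutive _ ⟨
    ⊝ ⊝ (B ⊗ A)     ≈⟨ 𝕄.-‿cong (ℙ.-‿distribʳ-* B A) ⟩
    ⊝ (B ⊗ (⊝ A))   ≈⟨ 𝕄.-‿cong (inverse-comm (⊝ A) B
                         (𝕄.trans (𝕄.sym (ℙ.-‿distribˡ-* A B)) (𝕄.trans (𝕄.-‿cong AB) (ℙ.-‿involutive _)))) ⟩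
    ⊝ identity n    ∎
    where
    module 𝕄 = Ring (matrixRing n)
    module ℙ = RingProperties (matrixRing n)
    open SetoidReasoning 𝕄.setoid

  -- Block matrices of size 2l.

  sum-++ : ∀ m {n} (f : Vector Carrier (m ℕ.+ n)) → sum f ≈ sum (f ∘ (_↑ˡ n)) + sum (f ∘ (m ↑ʳ_))
  sum-++ zero    f = sym (+-identityˡ _)
  sum-++ (suc m) f = trans (+-congˡ (sum-++ m (tail f))) (sym (+-assoc _ _ _))

  -- Indexing by a disjoint union lets each quadrant compute by pattern matching, whereas `block` is
  -- stuck on `splitAt`.
  quadrant : (A B C D : Mat) → Fin l ⊎ Fin l → Fin l ⊎ Fin l → Carrier
  quadrant A B C D (inj₁ i) (inj₁ j) = A i j
  quadrant A B C D (inj₁ i) (inj₂ j) = B i j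
  quadrant A B C D (inj₂ i) (inj₁ j) = C i j
  quadrant A B C D (inj₂ i) (inj₂ j) = D i j

  block-join : ∀ A B C D i j → block A B C D (join l l i) (join l l j) ≡ quadrant A B C D i j
  block-join A B C D (inj₁ i) (inj₁ j) rewrite splitAt-↑ˡ l i l | splitAt-↑ˡ l j l = ≡.refl
  block-join A B C D (inj₁ i) (inj₂ j) rewrite splitAt-↑ˡ l i l | splitAt-↑ʳ l l j = ≡.refl
  block-join A B C D (inj₂ i) (inj₁ j) rewrite splitAt-↑ʳ l l i | splitAt-↑ˡ l j l = ≡.refl
  block-join A B C D (inj₂ i) (inj₂ j) rewrite splitAt-↑ʳ l l i | splitAt-↑ʳ l l j = ≡.refl

  join-ext : {X Y : Matrix (l ℕ.+ l) (l ℕ.+ l)} →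
             (∀ i j → X (join l l i) (join l l j) ≈ Y (join l l i) (join l l j)) → X ≋ Y
  join-ext {X} {Y} h i j = ≡.subst₂ (λ i j → X i j ≈ Y i j) (join-splitAt l l i) (join-splitAt l l j)
    (h (splitAt l i) (splitAt l j))

  block-ext : ∀ {X A B C D} →
              (∀ i j → X (join l l i) (join l l j) ≈ quadrant A B C D i j) → X ≋ block A B C D
  block-ext {A = A} {B} {C} {D} h =
    join-ext (λ i j → trans (h i j) (reflexive (≡.sym (block-join A B C D i j))))

  block-cong : ∀ {A A′ B B′ C C′ D D′} → A ≋ A′ → B ≋ B′ → C ≋ C′ → D ≋ D′ →
               block A B C D ≋ block A′ B′ C′ D′
  block-cong {A} {A′} {B} {B′} {C} {C′} {D} {D′} a b c d = block-ext (λ i j →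
    trans (reflexive (block-join A B C D i j)) (quadrant-cong i j))
    where
    quadrant-cong : ∀ i j → quadrant A B C D i j ≈ quadrant A′ B′ C′ D′ i j
    quadrant-cong (inj₁ i) (inj₁ j) = a i j
    quadrant-cong (inj₁ i) (inj₂ j) = b i j
    quadrant-cong (inj₂ i) (inj₁ j) = c i j
    quadrant-cong (inj₂ i) (inj₂ j) = d i j

  ⊝-block : ∀ A B C D → ⊝ block A B C D ≋ block (⊝ A) (⊝ B) (⊝ C) (⊝ D)
  ⊝-block A B C D = block-ext (λ i j →
    trans (-‿cong (reflexive (block-join A B C D i j))) (quadrant-⊝ i j))
    where
    quadrant-⊝ : ∀ i j → - quadrant A B C D i j ≈ quadrant (⊝ A) (⊝ B) (⊝ C) (⊝ D) i j
    quadrant-⊝ (inj₁ i) (inj₁ j) = refl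
    quadrant-⊝ (inj₁ i) (inj₂ j) = refl
    quadrant-⊝ (inj₂ i) (inj₁ j) = refl
    quadrant-⊝ (inj₂ i) (inj₂ j) = refl

  block-⊗ : ∀ A B C D A′ B′ C′ D′ → block A B C D ⊗ block A′ B′ C′ D′ ≋
            block (A ⊗ A′ ⊕ B ⊗ C′) (A ⊗ B′ ⊕ B ⊗ D′) (C ⊗ A′ ⊕ D ⊗ C′) (C ⊗ B′ ⊕ D ⊗ D′)
  block-⊗ A B C D A′ B′ C′ D′ = block-ext (λ i j → trans (sum-++ l _) (trans
    (+-cong (sum-cong-≋ {l} (λ k → summand i (inj₁ k) j)) (sum-cong-≋ {l} (λ k → summand i (inj₂ k) j)))
    (quadrant-⊗ i j)))
    where
    q  = quadrant A B C D
    q′ = quadrant A′ B′ C′ D′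

    summand : ∀ i k j →
      block A B C D (join l l i) (join l l k) * block A′ B′ C′ D′ (join l l k) (join l l j) ≈ q i k * q′ k j
    summand i k j = reflexive (≡.cong₂ _*_ (block-join A B C D i k) (block-join A′ B′ C′ D′ k j))

    quadrant-⊗ : ∀ i j →
      sum (λ k → q i (inj₁ k) * q′ (inj₁ k) j) + sum (λ k → q i (inj₂ k) * q′ (inj₂ k) j) ≈
      quadrant (A ⊗ A′ ⊕ B ⊗ C′) (A ⊗ B′ ⊕ B ⊗ D′) (C ⊗ A′ ⊕ D ⊗ C′) (C ⊗ B′ ⊕ D ⊗ D′) i j
    quadrant-⊗ (inj₁ i) (inj₁ j) = refl
    quadrant-⊗ (inj₁ i) (inj₂ j) = refl
    quadrant-⊗ (inj₂ i) (inj₁ j) = refl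
    quadrant-⊗ (inj₂ i) (inj₂ j) = refl

  identity-block : identity (l ℕ.+ l) ≋ block I O O I
  identity-block = block-ext quadrants
    where
    ↑ˡ≢↑ʳ : ∀ i j → i ↑ˡ l ≢ l ↑ʳ j
    ↑ˡ≢↑ʳ i j eq with () ←
      ≡.trans (≡.sym (splitAt-↑ˡ l i l)) (≡.trans (≡.cong (splitAt l) eq) (splitAt-↑ʳ l l j))

    quadrants : ∀ i j → identity (l ℕ.+ l) (join l l i) (join l l j) ≈ quadrant I O O I i j
    quadrants (inj₁ i) (inj₁ j) = identity-injective (_↑ˡ l) (↑ˡ-injective l _ _) i j
    quadrants (inj₁ i) (inj₂ j) = identity-off-diagonal (↑ˡ≢↑ʳ i j)
    quadrants (inj₂ i) (inj₁ j) = identity-off-diagonal (↑ˡ≢↑ʳ j i ∘ ≡.sym)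
    quadrants (inj₂ i) (inj₂ j) = identity-injective (l ↑ʳ_) (↑ʳ-injective l _ _) i j

-- Collapse of the inserted factors and the composition of bi-sequences.

module Composition {c ℓ} (R : CommutativeRing c ℓ) (l : ℕ) where

  open Quiddity R l
  open MatrixAlgebra R l

  private
    module 𝕃 where
      open Ring (matrixRing l) public hiding (zero)
      open RingProperties (matrixRing l) public
    module 𝔹 where
      open Ring (matrixRing (l ℕ.+ l)) public hiding (zero)
      open RingProperties (matrixRing (l ℕ.+ l)) public

  -- A column operation: the second block column is subtracted from the first.
  M-⊖ : ∀ p q → M p q ⊗ block I O (⊝ I) I ≋ M (p ⊖ q) q
  M-⊖ p q = 𝔹.trans (block-⊗ p q I O I O (⊝ I) I) (block-cong
    (+-cong (*-identityʳ p) (trans (sym (-‿distribʳ-* q I)) (-‿cong (*-identityʳ q))))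
    (trans (+-cong (zeroʳ p) (*-identityʳ q)) (+-identityˡ q))
    (trans (+-cong (*-identityˡ I) (zeroˡ (⊝ I))) (+-identityʳ I))
    (trans (+-cong (zeroʳ I) (zeroˡ I)) (+-identityʳ O)))
    where open 𝕃

  -- A row operation: the second block row is added to the first.
  M-⊕ : ∀ p q → block I I O I ⊗ M p q ≋ M (p ⊕ I) q
  M-⊕ p q = 𝔹.trans (block-⊗ I I O I p q I O) (block-cong
    (+-cong (*-identityˡ p) (*-identityˡ I))
    (trans (+-cong (*-identityˡ q) (zeroʳ I)) (+-identityʳ q))
    (trans (+-cong (zeroˡ p) (*-identityˡ I)) (+-identityˡ I))
    (trans (+-cong (zeroˡ q) (zeroʳ I)) (+-identityʳ O)))
    where open 𝕃

  M-merge : ∀ p q 𝔩 𝔰 → block (⊝ q) (p ⊖ q) O I ⊗ M 𝔩 𝔰 ≋ M ((p ⊖ q) ⊖ q ⊗ 𝔩) (⊝ (q ⊗ 𝔰))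
  M-merge p q 𝔩 𝔰 = 𝔹.trans (block-⊗ (⊝ q) (p ⊖ q) O I 𝔩 𝔰 I O) (block-cong
    (trans (+-comm _ _) (+-cong (*-identityʳ (p ⊖ q)) (sym (-‿distribˡ-* q 𝔩))))
    (trans (+-cong (sym (-‿distribˡ-* q 𝔰)) (zeroʳ (p ⊖ q))) (+-identityʳ _))
    (trans (+-cong (zeroˡ 𝔩) (*-identityˡ I)) (+-identityˡ I))
    (trans (+-cong (zeroˡ 𝔰) (zeroʳ I)) (+-identityʳ O)))
    where open 𝕃

  ⊖⊗⊕ : block I O (⊝ I) I ⊗ block I I O I ≋ block I I (⊝ I) O
  ⊖⊗⊕ = 𝔹.trans (block-⊗ I O (⊝ I) I I I O I) (block-cong
    (trans (+-cong (*-identityˡ I) (zeroʳ O)) (+-identityʳ I))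
    (trans (+-cong (*-identityˡ I) (zeroˡ I)) (+-identityʳ I))
    (trans (+-cong (*-identityʳ (⊝ I)) (zeroʳ I)) (+-identityʳ (⊝ I)))
    (trans (+-cong (*-identityʳ (⊝ I)) (*-identityˡ I)) (-‿inverseˡ I)))
    where open 𝕃

  -- This equation determines the left factor, as - `M p q` times the inverse of the invertible
  -- matrix `block I I (⊝ I) O`.
  merge⊗⊖⊗⊕ : ∀ p q → block (⊝ q) (p ⊖ q) O I ⊗ (block I O (⊝ I) I ⊗ block I I O I) ≋ ⊝ M p q
  merge⊗⊖⊗⊕ p q = 𝔹.trans (𝔹.*-congˡ ⊖⊗⊕) (𝔹.trans (block-⊗ (⊝ q) (p ⊖ q) O I I I (⊝ I) O) (𝔹.trans (block-cong
    (begin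
      ⊝ q ⊗ I ⊕ (p ⊖ q) ⊗ (⊝ I)  ≈⟨ +-cong (*-identityʳ (⊝ q))
                                      (trans (sym (-‿distribʳ-* (p ⊖ q) I)) (-‿cong (*-identityʳ (p ⊖ q)))) ⟩
      ⊝ q ⊖ (p ⊖ q)              ≈⟨ +-congˡ (⁻¹-anti-homo-// p q) ⟩
      ⊝ q ⊕ (q ⊖ p)              ≈⟨ +-assoc (⊝ q) q (⊝ p) ⟨
      ⊝ q ⊕ q ⊖ p                ≈⟨ +-congʳ (-‿inverseˡ q) ⟩
      0# ⊖ p                     ≈⟨ +-identityˡ (⊝ p) ⟩
      ⊝ p                        ∎)
    (trans (+-cong (*-identityʳ (⊝ q)) (zeroʳ (p ⊖ q))) (+-identityʳ (⊝ q)))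
    (trans (+-cong (zeroˡ I) (*-identityˡ (⊝ I))) (+-identityˡ (⊝ I)))
    (trans (+-cong (zeroˡ I) (zeroʳ I)) (trans (+-identityʳ O) (sym -0#≈0#))))
    (𝔹.sym (⊝-block p q I O))))
    where
    open 𝕃
    open SetoidReasoning setoid

  -- The step shared by all k. V stands for the factors of the inserted bi-sequence from the third
  -- on, and the bracketing is the one that `listProduct` produces.
  insertion : ∀ V p q p′ q′ 𝔩 𝔰 𝔩₂ 𝔰₂ → (V ⊗ M 𝔩₂ 𝔰₂) ⊗ M 𝔩 𝔰 ≋ ⊝ identity (l ℕ.+ l) →
    ((M ((p ⊖ q) ⊖ q ⊗ 𝔩) (⊝ (q ⊗ 𝔰)) ⊗ V) ⊗ M (𝔩₂ ⊖ 𝔰₂) 𝔰₂) ⊗ M (p′ ⊕ I) q′ ≋ M p q ⊗ M p′ q′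
  insertion V p q p′ q′ 𝔩 𝔰 𝔩₂ 𝔰₂ h = begin
    ((M ((p ⊖ q) ⊖ q ⊗ 𝔩) (⊝ (q ⊗ 𝔰)) ⊗ V) ⊗ M (𝔩₂ ⊖ 𝔰₂) 𝔰₂) ⊗ M (p′ ⊕ I) q′
      ≈⟨ *-cong (*-cong (*-congʳ (M-merge p q 𝔩 𝔰)) (M-⊖ 𝔩₂ 𝔰₂)) (M-⊕ p′ q′) ⟨
    (((T ⊗ M 𝔩 𝔰) ⊗ V) ⊗ (M 𝔩₂ 𝔰₂ ⊗ N)) ⊗ (J ⊗ M p′ q′)
      ≈⟨ *-assoc _ J (M p′ q′) ⟨
    ((((T ⊗ M 𝔩 𝔰) ⊗ V) ⊗ (M 𝔩₂ 𝔰₂ ⊗ N)) ⊗ J) ⊗ M p′ q′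
      ≈⟨ *-congʳ (trans (*-assoc _ (M 𝔩₂ 𝔰₂ ⊗ N) J) (*-congˡ (*-assoc (M 𝔩₂ 𝔰₂) N J))) ⟩
    (((T ⊗ M 𝔩 𝔰) ⊗ V) ⊗ (M 𝔩₂ 𝔰₂ ⊗ (N ⊗ J))) ⊗ M p′ q′
      ≈⟨ *-congʳ (*-assoc _ (M 𝔩₂ 𝔰₂) (N ⊗ J)) ⟨
    ((((T ⊗ M 𝔩 𝔰) ⊗ V) ⊗ M 𝔩₂ 𝔰₂) ⊗ (N ⊗ J)) ⊗ M p′ q′
      ≈⟨ *-congʳ (*-congʳ (trans (*-assoc _ V (M 𝔩₂ 𝔰₂)) (*-assoc T (M 𝔩 𝔰) (V ⊗ M 𝔩₂ 𝔰₂)))) ⟩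
    ((T ⊗ (M 𝔩 𝔰 ⊗ (V ⊗ M 𝔩₂ 𝔰₂))) ⊗ (N ⊗ J)) ⊗ M p′ q′
      -- The hypothesis has `M 𝔩 𝔰` on the right, while here it stands on the left.
      ≈⟨ *-congʳ (*-congʳ (*-congˡ (negative-inverse-comm (V ⊗ M 𝔩₂ 𝔰₂) (M 𝔩 𝔰) h))) ⟩
    ((T ⊗ (⊝ 1#)) ⊗ (N ⊗ J)) ⊗ M p′ q′
      ≈⟨ *-congʳ (*-congʳ (trans (sym (-‿distribʳ-* T 1#)) (-‿cong (*-identityʳ T)))) ⟩
    ((⊝ T) ⊗ (N ⊗ J)) ⊗ M p′ q′
      ≈⟨ *-congʳ (-‿distribˡ-* T (N ⊗ J)) ⟨
    (⊝ (T ⊗ (N ⊗ J))) ⊗ M p′ q′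
      -- The sign from the inserted bi-sequence cancels the sign of `merge⊗⊖⊗⊕`.
      ≈⟨ *-congʳ (trans (-‿cong (merge⊗⊖⊗⊕ p q)) (-‿involutive (M p q))) ⟩
    M p q ⊗ M p′ q′ ∎
    where
    open 𝔹
    open SetoidReasoning setoid
    T = block (⊝ q) (p ⊖ q) O I
    N = block I O (⊝ I) I
    J = block I I O I

  -- Lists carry no length in their type, so casts disappear and reassociation is an equation. The
  -- catch-all clause ignores the surplus of a longer list.
  listProduct : List Mat → List Mat → Matrix (l ℕ.+ l) (l ℕ.+ l)
  listProduct (p ∷ ps) (q ∷ qs) = listProduct ps qs ⊗ M p q
  listProduct _        _        = identity (l ℕ.+ l)

  product-toList : ∀ {n} (p q : Vector Mat n) → product p q ≡ listProduct (toList p) (toList q)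
  product-toList {zero}  p q = ≡.refl
  product-toList {suc n} p q = ≡.cong (_⊗ M (p zero) (q zero)) (product-toList (tail p) (tail q))

  -- The order flips because later factors stand on the left. Equal prefix lengths make both lists
  -- break at the same index.
  listProduct-++ : ∀ ps qs {ps′ qs′} → length ps ≡ length qs →
    listProduct (ps ++ ps′) (qs ++ qs′) ≋ listProduct ps′ qs′ ⊗ listProduct ps qs
  listProduct-++ []       []       eq = 𝔹.sym (𝔹.*-identityʳ _)
  listProduct-++ (p ∷ ps) (q ∷ qs) eq =
    𝔹.trans (𝔹.*-congʳ (listProduct-++ ps qs (ℕ.suc-injective eq))) (𝔹.*-assoc _ _ _)

  toList-length : ∀ {n} (p q : Vector Mat n) → length (toList p) ≡ length (toList q)
  toList-length p q = ≡.trans (length-tabulate p) (≡.sym (length-tabulate q))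

  LMQB⇒ : ∀ {n} (p q : Vector Mat n) → (p , q) ∈ LMQB n →
          listProduct (toList p) (toList q) ≋ ⊝ identity (l ℕ.+ l)
  LMQB⇒ p q h = ≡.subst (_≋ ⊝ identity (l ℕ.+ l)) (product-toList p q)
    (𝔹.trans h (𝔹.-‿cong (𝔹.sym identity-block)))

  ⇒LMQB : ∀ {n ps qs} (pq : BiVector n) → toList (proj₁ pq) ≡ ps → toList (proj₂ pq) ≡ qs →
          listProduct ps qs ≋ ⊝ identity (l ℕ.+ l) → pq ∈ LMQB n
  ⇒LMQB (p , q) ≡.refl ≡.refl h = ≡.subst (_≋ ⊝ block I O O I) (≡.sym (product-toList p q))
    (𝔹.trans h (𝔹.-‿cong identity-block))

  •-LMQB : ∀ {n m} (pq : BiVector (2 ℕ.+ n)) (ls : BiVector (2 ℕ.+ m)) →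
    pq ∈ LMQB (2 ℕ.+ n) → ls ∈ LMQB (2 ℕ.+ m) →
    ∀ (k : Fin (2 ℕ.+ n)) → (pq •[ k ] ls) ∈ LMQB ((2 ℕ.+ n) ℕ.+ (2 ℕ.+ m) ℕ.∸ 1)
  •-LMQB {n} {m} (p , q) (𝔩 , 𝔰) hp hl k@0F = ⇒LMQB ((p , q) •[ k ] (𝔩 , 𝔰))
    (≡.cong (x ∷_) (toList-++ (tail (init p)) P))
    (≡.trans (toList-cast (≡.cong suc (≡.sym (ℕ.+-suc n (suc m)))) (y Vector.∷ tail q Vector.++ tail 𝔰))
      -- The last entry of `tail q` is split off, so that this list breaks where the first component
      -- does.
      (≡.cong (y ∷_) (≡.trans (toList-++ (tail q) (tail 𝔰)) (≡.trans (≡.cong (_++ toList (tail 𝔰)) (toList-init-last (tail q)))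
        (++-assoc qₘ _ _)))))
    (begin
      listProduct (pₘ ++ _) (qₘ ++ _) ⊗ X
        ≈⟨ *-congʳ (listProduct-++ pₘ qₘ (toList-length (tail (init p)) _)) ⟩
      (((V ⊗ M₂) ⊗ Mₙ) ⊗ Z) ⊗ X
        -- First rotation: X, the rightmost factor, moves to the left end, next to V, where
        -- `insertion` applies.
        ≈⟨ negative-inverse-comm X _ (begin
          X ⊗ (((V ⊗ M₂) ⊗ Mₙ) ⊗ Z)
            ≈⟨ trans (sym (*-assoc X _ Z)) (*-congʳ (trans (sym (*-assoc X _ Mₙ)) (*-congʳ (sym (*-assoc X V M₂))))) ⟩
          (((X ⊗ V) ⊗ M₂) ⊗ Mₙ) ⊗ Z
            ≈⟨ *-congʳ (insertion V (p 0F) (q 0F) (last p) (last q) (𝔩 0F) (𝔰 0F) (𝔩 1F) (𝔰 1F) (LMQB⇒ 𝔩 𝔰 hl)) ⟩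
          (M (p 0F) (q 0F) ⊗ M (last p) (last q)) ⊗ Z
            ≈⟨ *-assoc _ _ Z ⟩
          M (p 0F) (q 0F) ⊗ (M (last p) (last q) ⊗ Z)
            -- Second rotation: the restored first factor returns to the right end.
            ≈⟨ negative-inverse-comm _ (M (p 0F) (q 0F)) (begin
              (M (last p) (last q) ⊗ Z) ⊗ M (p 0F) (q 0F)
                ≈⟨ *-congʳ (*-congʳ (*-identityˡ _)) ⟨
              (listProduct (last p ∷ []) (last q ∷ []) ⊗ Z) ⊗ M (p 0F) (q 0F)
                ≈⟨ *-congʳ (listProduct-++ pₘ qₘ (toList-length (tail (init p)) _)) ⟨
              listProduct (toList (init p) ++ last p ∷ []) (toList (init q) ++ last q ∷ [])
                ≡⟨ ≡.cong₂ listProduct (toList-init-last p) (toList-init-last q) ⟨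
              listProduct (toList p) (toList q)
                ≈⟨ LMQB⇒ p q hp ⟩
              ⊝ 1# ∎) ⟩
          ⊝ 1# ∎) ⟩
      ⊝ 1# ∎)
    where
    open 𝔹
    open SetoidReasoning setoid
    pₘ = toList (tail (init p))
    qₘ = toList (tail (init q))
    x  = (p 0F ⊖ q 0F) ⊖ q 0F ⊗ 𝔩 0F
    y  = ⊝ (q 0F ⊗ 𝔰 0F)
    P  = (last p ⊕ I) Vector.∷ (𝔩 1F ⊖ 𝔰 1F) Vector.∷ tail (tail 𝔩)
    X  = M x y
    V  = listProduct (toList (tail (tail 𝔩))) (toList (tail (tail 𝔰)))
    M₂ = M (𝔩 1F ⊖ 𝔰 1F) (𝔰 1F)
    Mₙ = M (last p ⊕ I) (last q)
    Z  = listProduct pₘ qₘ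
  •-LMQB {n} {m} (p , q) (𝔩 , 𝔰) hp hl k@(suc j) = ⇒LMQB ((p , q) •[ k ] (𝔩 , 𝔰))
    (≡.trans (toList-cast (length₁ m j) (before (inject₁ j) p Vector.++ P)) (≡.trans (toList-++ (before (inject₁ j) p) P)
      (≡.cong (λ ps → pₗ ++ x′ ∷ x₂ ∷ ps)
        (toList-++ (tail (tail 𝔩)) (x Vector.∷ after (suc j) p)))))
    (≡.trans (toList-cast (length₂ m j) (before (suc j) q Vector.++ Q)) (≡.trans (toList-++ (before (suc j) q) Q)
      -- The entry at position k - 1 leaves the prefix, which then has the length of `pₗ`.
      (≡.trans (≡.cong₂ _++_ (toList-before-suc j q) (toList-++ (tail 𝔰) (y Vector.∷ after (suc j) q)))
        (++-assoc qₗ _ _))))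
    (begin
      listProduct (pₗ ++ _) (qₗ ++ _)
        ≈⟨ listProduct-++ pₗ qₗ (toList-length (before (inject₁ j) p) _) ⟩
      ((listProduct (𝔩ᵣ ++ _) (𝔰ᵣ ++ _) ⊗ M₂) ⊗ Mₖ) ⊗ Z
        ≈⟨ *-congʳ (*-congʳ (*-congʳ (listProduct-++ 𝔩ᵣ 𝔰ᵣ (toList-length (tail (tail 𝔩)) _)))) ⟩
      ((((Y ⊗ X) ⊗ V) ⊗ M₂) ⊗ Mₖ) ⊗ Z
        ≈⟨ *-congʳ (trans (*-congʳ (trans (*-congʳ (*-assoc Y X V)) (*-assoc Y _ M₂))) (*-assoc Y _ Mₖ)) ⟩
      (Y ⊗ (((X ⊗ V) ⊗ M₂) ⊗ Mₖ)) ⊗ Z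
        ≈⟨ *-congʳ (*-congˡ (insertion V (p (suc j)) (q (suc j)) (p (inject₁ j)) (q (inject₁ j))
             (𝔩 0F) (𝔰 0F) (𝔩 1F) (𝔰 1F) (LMQB⇒ 𝔩 𝔰 hl))) ⟩
      (Y ⊗ (M (p (suc j)) (q (suc j)) ⊗ M (p (inject₁ j)) (q (inject₁ j)))) ⊗ Z
        ≈⟨ *-congʳ (*-assoc Y _ _) ⟨
      ((Y ⊗ M (p (suc j)) (q (suc j))) ⊗ M (p (inject₁ j)) (q (inject₁ j))) ⊗ Z
        ≈⟨ listProduct-++ pₗ qₗ (toList-length (before (inject₁ j) p) _) ⟨
      listProduct (pₗ ++ p (inject₁ j) ∷ p (suc j) ∷ pᵣ)
                  (qₗ ++ q (inject₁ j) ∷ q (suc j) ∷ qᵣ)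
        ≡⟨ ≡.cong₂ listProduct (toList-before-after j p) (toList-before-after j q) ⟨
      listProduct (toList p) (toList q)
        ≈⟨ LMQB⇒ p q hp ⟩
      ⊝ 1# ∎)
    where
    open 𝔹
    open SetoidReasoning setoid
    pₗ = toList (before (inject₁ j) p)
    qₗ = toList (before (inject₁ j) q)
    pᵣ = toList (after (suc j) p)
    qᵣ = toList (after (suc j) q)
    𝔩ᵣ = toList (tail (tail 𝔩))
    𝔰ᵣ = toList (tail (tail 𝔰))
    x  = (p (suc j) ⊖ q (suc j)) ⊖ q (suc j) ⊗ 𝔩 0F
    y  = ⊝ (q (suc j) ⊗ 𝔰 0F)
    x′ = p (inject₁ j) ⊕ I
    x₂ = 𝔩 1F ⊖ 𝔰 1F
    P  = x′ Vector.∷ x₂ Vector.∷ tail (tail 𝔩) Vector.++ x Vector.∷ after (suc j) p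
    Q  = tail 𝔰 Vector.++ y Vector.∷ after (suc j) q
    X  = M x y
    Y  = listProduct pᵣ qᵣ
    V  = listProduct 𝔩ᵣ 𝔰ᵣ
    M₂ = M (𝔩 1F ⊖ 𝔰 1F) (𝔰 1F)
    Mₖ = M (p (inject₁ j) ⊕ I) (q (inject₁ j))
    Z  = listProduct pₗ qₗ

open import Data.Nat.Base using (_+_; _∸_; NonZero)

theorem33 : ∀ {c ℓ} (R : CommutativeRing c ℓ) (l : ℕ) .{{_ : NonZero l}} →
    let open Quiddity R l in
    ∀ {n m} (pq : BiVector (2 + n)) (ls : BiVector (2 + m)) →
    pq ∈ LMQB (2 + n) → ls ∈ LMQB (2 + m) →
    ∀ (k : Fin (2 + n)) → (pq •[ k ] ls) ∈ LMQB ((2 + n) + (2 + m) ∸ 1)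
theorem33 R l = Composition.•-LMQB R l
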